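{- Let $G'=(V',E')$ be a graph and let $G=(V,E)$ be a vertex-induced subgraph of $G'$ such that: (i) every $v\in V'\setminus V$ has $\deg(v)<n$ in $G'$; (ii) $\operatorname{col}_{ve}(G)=n$; and (iii) in the vertex-edge marking game on $G$, Alice has a strategy which, at the end of each of her turns, leaves no unmarked vertex incident to $n-1$ marked edges. Then $\operatorname{col}_{ve}(G')=n$.
   Context: The vertex-edge marking game on a graph $G=(V,E)$ (finite or infinite) is played by Alice, who marks vertices, and Bob, who marks edges. Initially nothing is marked. The game proceeds in rounds $r=1,2,\dots$; in each round Alice first marks one unmarked vertex, then Bob marks one unmarked edge. For a finite graph the game ends when either player has no move; for an infinite graph it continues forever. After round $r$, the vertex score of $v$ is $0$ if $v$ is marked, and otherwise the number of marked edges incident to $v$. The $r$-round score is the supremum over $v\in V$ of the vertex scores after round $r$, and the final score of the game is the supremum of the $r$-round scores over all rounds. Bob has a winning strategy for score $s$ if, whatever Alice plays, Bob can force the final score to be at least $s$. The vertex-edge coloring number is $\operatorname{col}_{ve}(G)=\sup\{s : \text{Bob has a winning strategy for score } s\}+1$. -}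

module Defs where

open import Axiom.ExcludedMiddle using (ExcludedMiddle)
open import Data.Bool using (if_then_else_)
open import Data.List using (List; []; _∷_; length; filter)
open import Data.List.Membership.Propositional using (_∈_; _∉_)
open import Data.List.Relation.Unary.Any using (Any)
open import Data.List.Relation.Unary.Unique.Propositional using (Unique)
open import Data.Maybe using (Maybe; just; nothing; _>>=_)
open import Data.Nat using (ℕ; zero; suc; _≤_; _<_)
open import Data.Product using (Σ-syntax; ∃-syntax; _×_; _,_)
open import Data.Refinement using (Refinement; value)
open import Data.Sum using (_⊎_)
open import Function using (_⇔_)
open import Level using (Level) renaming (suc to lsuc)
open import Relation.Binary.PropositionalEquality using (_≡_)
open import Relation.Nullary using (¬_; Dec; yes; no; does)
open import Relation.Unary using (Pred)

-- Simple graphs, finite or infinite.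
record Graph (ℓ : Level) : Set (lsuc ℓ) where
  field
    Vertex : Set ℓ
    Adj    : Vertex → Vertex → Set ℓ
    sym    : ∀ {u v} → Adj u v → Adj v u
    irrefl : ∀ {v} → ¬ Adj v v

open Graph public using (Vertex; Adj)

-- The membership proof is irrelevant, so two vertices of the subgraph are
-- equal exactly when they are equal in the big graph.
induced : ∀ {ℓ} (G : Graph ℓ) → Pred (Vertex G) ℓ → Graph ℓ
induced G S = record
  { Vertex = Refinement (Vertex G) S
  ; Adj    = λ u v → Adj G (value u) (value v)
  ; sym    = Graph.sym G
  ; irrefl = Graph.irrefl G
  }

HasDegree : ∀ {ℓ} (G : Graph ℓ) → Vertex G → ℕ → Set ℓ
HasDegree G v d = Σ[ us ∈ List (Vertex G) ]
  Unique us × (∀ u → u ∈ us ⇔ Adj G v u) × length us ≡ d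

-- In particular the degree is finite.
Degree< : ∀ {ℓ} (G : Graph ℓ) → Vertex G → ℕ → Set ℓ
Degree< G v n = ∃[ d ] HasDegree G v d × d < n

-- s ≤sup P says s ≤ sup P, the supremum being taken in ℕ ∪ {∞}
-- (so that sup ∅ = 0); IsSup P m says sup P = m.
_≤sup_ : ∀ {ℓ} → ℕ → Pred ℕ ℓ → Set ℓ
s ≤sup P = ∀ b → (∀ k → P k → k ≤ b) → s ≤ b

IsSup : ∀ {ℓ} → Pred ℕ ℓ → ℕ → Set ℓ
IsSup P m = (∀ k → P k → k ≤ m) × m ≤sup P

-- An edge is given by its endpoints in either order; two edges are
-- identified by SameEdge.
record Edge {ℓ} (G : Graph ℓ) : Set ℓ where
  constructor edge
  field
    end₁ end₂ : Vertex G
    adjacent  : Adj G end₁ end₂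

module _ {ℓ} {G : Graph ℓ} where
  open Edge

  SameEdge : Edge G → Edge G → Set ℓ
  SameEdge e f = (end₁ e ≡ end₁ f × end₂ e ≡ end₂ f)
               ⊎ (end₁ e ≡ end₂ f × end₂ e ≡ end₁ f)

  Incident : Vertex G → Edge G → Set ℓ
  Incident v e = v ≡ end₁ e ⊎ v ≡ end₂ e

-- Excluded middle is used to compute the scores of an arbitrary graph.
module Game {ℓ} (em : ExcludedMiddle ℓ) (G : Graph ℓ) where

  -- The marks made so far, most recent first; as the players alternate,
  -- this is the complete history of the game.
  record Position : Set ℓ where
    constructor position
    field
      vertices : List (Vertex G)
      edges    : List (Edge G)

  open Position public

  start : Position
  start = position [] []

  markedDegree : Position → Vertex G → ℕ
  markedDegree p v = length (filter (λ e → em {Incident v e}) (edges p))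

  vertexScore : Position → Vertex G → ℕ
  vertexScore p v = if does (em {v ∈ vertices p}) then 0 else markedDegree p v

  AliceMove : Position → Set ℓ
  AliceMove p = Σ[ v ∈ Vertex G ] v ∉ vertices p

  BobMove : Position → Set ℓ
  BobMove p = Σ[ e ∈ Edge G ] ¬ Any (SameEdge e) (edges p)

  -- A strategy selects a legal move, and may decline to do so only when
  -- there is none.
  AliceStrategy : Set ℓ
  AliceStrategy = ∀ p → Dec (AliceMove p)

  BobStrategy : Set ℓ
  BobStrategy = ∀ p → Dec (BobMove p)

  -- nothing: the game has ended for lack of a move.
  aliceTurn : AliceStrategy → Position → Maybe Position
  aliceTurn α p with α p
  ... | yes (v , _) = just (position (v ∷ vertices p) (edges p))
  ... | no _        = nothing

  bobTurn : BobStrategy → Position → Maybe Position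
  bobTurn β p with β p
  ... | yes (e , _) = just (position (vertices p) (e ∷ edges p))
  ... | no _        = nothing

  -- afterRound α β r is the position at the end of round r, or nothing if
  -- the game ends before round r is completed.
  afterRound      : AliceStrategy → BobStrategy → ℕ → Maybe Position
  afterAlicesTurn : AliceStrategy → BobStrategy → ℕ → Maybe Position

  afterRound α β zero    = just start
  afterRound α β (suc r) = afterAlicesTurn α β (suc r) >>= bobTurn β

  afterAlicesTurn α β zero    = nothing
  afterAlicesTurn α β (suc r) = afterRound α β r >>= aliceTurn α

  -- The r-round score is k.  The vertex scores in a position are bounded by
  -- its number of marked edges, so every completed round has a score in ℕ.
  RoundScore : AliceStrategy → BobStrategy → ℕ → Pred ℕ ℓ
  RoundScore α β r k = ∃[ p ] afterRound α β r ≡ just p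
                            × IsSup (λ j → ∃[ v ] vertexScore p v ≡ j) k

  FinalScore≥ : AliceStrategy → BobStrategy → ℕ → Set ℓ
  FinalScore≥ α β s = s ≤sup (λ k → ∃[ r ] 1 ≤ r × RoundScore α β r k)

  BobWins : ℕ → Set ℓ
  BobWins s = Σ[ β ∈ BobStrategy ] ∀ (α : AliceStrategy) → FinalScore≥ α β s

  -- col_ve(G) = n, for a natural number n.
  ColVe : ℕ → Set ℓ
  ColVe n = ∃[ m ] IsSup BobWins m × n ≡ suc m

  AliceCanAvoid : ℕ → Set ℓ
  AliceCanAvoid k = Σ[ α ∈ AliceStrategy ] ∀ (β : BobStrategy) r q →
    afterAlicesTurn α β r ≡ just q →
    ¬ (∃[ v ] v ∉ vertices q × markedDegree q v ≡ k)

{-# OPTIONS --safe #-}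
module Submission where

-- Lower bound: on G′ Bob follows a strategy for G, imagining a game on G in
-- which a move of Alice outside V, or on a vertex already marked in the
-- imagined game, is replaced by an arbitrary one.  The marked edges agree and
-- every real mark in V is also an imagined mark, so the real score is at least
-- the imagined one.
--
-- Upper bound: Alice replays her avoiding strategy for G against the marked
-- edges inside V, and answers an edge leaving V by marking its end in V.  After
-- her turns an unmarked vertex of V then meets only marked edges inside V, and
-- fewer than n − 1 of them, so Bob's next move brings it to at most n − 1; a
-- vertex outside V cannot exceed its degree, which is at most n − 1.

open import Axiom.ExcludedMiddle using (ExcludedMiddle)
open import Data.Nat using (ℕ; _∸_)
open import Relation.Unary using (Pred; _∉_)
open import Defs
open Game using (ColVe; AliceCanAvoid)

open import Data.Irrelevant using ([_])
open import Data.List using (List; []; _∷_; _++_; length; filter; map)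
open import Data.List.Membership.Propositional as List using (_∈_)
open import Data.List.Membership.Propositional.Properties using (∈-∃++; ∈-++⁺ˡ; ∈-++⁺ʳ; ∈-++⁻)
open import Data.List.Properties using (length-++; length-filter; filter-accept; filter-reject; ∷-injectiveˡ)
open import Data.List.Relation.Binary.Subset.Propositional using (_⊆_)
open import Data.List.Relation.Unary.All using (All; []; _∷_; reduce; lookup)
open import Data.List.Relation.Unary.All.Properties using (¬Any⇒All¬; All¬⇒¬Any; all-filter)
open import Data.List.Relation.Unary.AllPairs using (AllPairs; []; _∷_)
open import Data.List.Relation.Unary.AllPairs.Properties using (filter⁺)
open import Data.List.Relation.Unary.Any using (Any; here; there)
open import Data.List.Relation.Unary.Unique.Propositional using (Unique)
open import Data.Maybe using (Maybe; just; nothing; fromMaybe; _>>=_)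
open import Data.Maybe.Properties using (just-injective)
open import Data.Nat using (zero; suc; _+_; _≤_; _<_; z≤n; s≤s; s≤s⁻¹)
open import Data.Nat.Properties using (≤-refl; ≤-reflexive; ≤-trans; ≤∧≢⇒<; <⇒≢; <-trans; n<1+n; n≤1+n; +-suc; module ≤-Reasoning)
open import Data.Product using (Σ-syntax; ∃-syntax; _×_; _,_; proj₁; proj₂)
open import Data.Refinement using (value; value-injective; _,_)
open import Data.Sum using (_⊎_; inj₁; inj₂)
open import Function using (_∘_; Equivalence)
open import Level using (Level)
open import Relation.Binary.PropositionalEquality using (_≡_; _≢_; refl; sym; trans; cong; subst; module ≡-Reasoning)
open import Relation.Nullary using (¬_; yes; no; contradiction)
open import Relation.Nullary.Decidable using (decidable-stable; recompute)

private variable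
  a b ℓ : Level
  A B : Set a

-- Lists and bounded suprema.

>>=-just⁻ : (x : Maybe A) {f : A → Maybe B} {z : B} → (x >>= f) ≡ just z →
            ∃[ y ] x ≡ just y × f y ≡ just z
>>=-just⁻ (just y) eq = y , refl , eq

-- Pigeonhole: cut one occurrence of the head out of `ys`; by uniqueness the tail of `xs` still lies
-- in the rest.
Unique-⊆⇒length≤ : {xs ys : List A} → Unique xs → xs ⊆ ys → length xs ≤ length ys
Unique-⊆⇒length≤ [] _ = z≤n
Unique-⊆⇒length≤ {xs = x ∷ xs} (x≢xs ∷ xs!) x∷xs⊆ys with ∈-∃++ (x∷xs⊆ys (here refl))
... | as , bs , refl = begin
  suc (length xs)             ≤⟨ s≤s (Unique-⊆⇒length≤ xs! xs⊆as++bs) ⟩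
  suc (length (as ++ bs))     ≡⟨ cong suc (length-++ as) ⟩
  suc (length as + length bs) ≡⟨ +-suc (length as) (length bs) ⟨
  length as + suc (length bs) ≡⟨ length-++ as ⟨
  length (as ++ x ∷ bs)       ∎
  where
  open ≤-Reasoning
  xs⊆as++bs : xs ⊆ as ++ bs
  xs⊆as++bs y∈xs with ∈-++⁻ as (x∷xs⊆ys (there y∈xs))
  ... | inj₁ y∈as          = ∈-++⁺ˡ y∈as
  ... | inj₂ (here refl)   = contradiction refl (lookup x≢xs y∈xs)
  ... | inj₂ (there y∈bs)  = ∈-++⁺ʳ as y∈bs

-- Search downwards from the bound: the first value attained is the supremum. The base case also
-- covers an empty `P`, whose supremum is 0.
bounded⇒IsSup : ExcludedMiddle ℓ → (P : Pred ℕ ℓ) (b : ℕ) → (∀ k → P k → k ≤ b) → ∃[ m ] IsSup P m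
bounded⇒IsSup em P zero    P≤b = 0 , P≤b , λ _ _ → z≤n
bounded⇒IsSup em P (suc b) P≤b with em {P (suc b)}
... | yes Pb = suc b , P≤b , λ _ P≤c → P≤c (suc b) Pb
... | no ¬Pb = bounded⇒IsSup em P b λ k Pk →
  s≤s⁻¹ (≤∧≢⇒< (P≤b k Pk) λ { refl → ¬Pb Pk })

-- Distinct edges at a vertex and their far ends.

module Opposites (G : Graph ℓ) where
  open Edge

  Distinct : List (Edge G) → Set ℓ
  Distinct = AllPairs (λ e f → ¬ SameEdge e f)

  opposite : ∀ {v} (e : Edge G) → Incident v e → Vertex G
  opposite e (inj₁ _) = end₂ e
  opposite e (inj₂ _) = end₁ e

  opposite-adjacent : ∀ {v} e (i : Incident v e) → Adj G v (opposite e i)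
  opposite-adjacent e (inj₁ refl) = adjacent e
  opposite-adjacent e (inj₂ refl) = Graph.sym G (adjacent e)

  -- In a simple graph an edge at `v` is determined, up to orientation, by its other end.
  opposite-injective : ∀ {v} e f (i : Incident v e) (j : Incident v f) →
                       opposite e i ≡ opposite f j → SameEdge e f
  opposite-injective e f (inj₁ p) (inj₁ q) eq = inj₁ (trans (sym p) q , eq)
  opposite-injective e f (inj₁ p) (inj₂ q) eq = inj₂ (trans (sym p) q , eq)
  opposite-injective e f (inj₂ p) (inj₁ q) eq = inj₂ (eq , trans (sym p) q)
  opposite-injective e f (inj₂ p) (inj₂ q) eq = inj₁ (eq , trans (sym p) q)

  opposites : ∀ {v es} → All (Incident v) es → List (Vertex G)
  opposites = reduce (λ {e} → opposite e)

  length-opposites : ∀ {v es} (is : All (Incident v) es) → length (opposites is) ≡ length es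
  length-opposites []       = refl
  length-opposites (_ ∷ is) = cong suc (length-opposites is)

  opposites-Unique : ∀ {v es} (is : All (Incident v) es) → Distinct es → Unique (opposites is)
  opposites-Unique []                 []         = []
  opposites-Unique {v} (_∷_ {e} i is) (e≁ ∷ es!) = opposite≢ is e≁ ∷ opposites-Unique is es!
    where
    opposite≢ : ∀ {fs} (js : All (Incident v) fs) → All (λ f → ¬ SameEdge e f) fs →
                All (opposite e i ≢_) (opposites js)
    opposite≢ []             []       = []
    opposite≢ (_∷_ {f} j js) (≁ ∷ ≁s) = ≁ ∘ opposite-injective e f i j ∷ opposite≢ js ≁s

  opposites-adjacent : ∀ {v es w} (is : All (Incident v) es) → w ∈ opposites is → Adj G v w
  opposites-adjacent (_∷_ {e} i _) (here refl) = opposite-adjacent e i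
  opposites-adjacent (_ ∷ is)      (there w∈)  = opposites-adjacent is w∈

-- Mark counts, scores and invariants of plays.

module Plays (em : ExcludedMiddle ℓ) (G : Graph ℓ) where
  open Game em G
  open Opposites G public

  -- `markedDegree` ignores the marked vertices, so `marks (edges p) v` is definitionally
  -- `markedDegree p v`.
  marks : List (Edge G) → Vertex G → ℕ
  marks es = markedDegree (position [] es)

  marks-∷-incident : ∀ {v} e es → Incident v e → marks (e ∷ es) v ≡ suc (marks es v)
  marks-∷-incident {v} e es i = cong length (filter-accept (λ f → em {Incident v f}) {e} {es} i)

  marks-∷-¬incident : ∀ {v} e es → ¬ Incident v e → marks (e ∷ es) v ≡ marks es v
  marks-∷-¬incident {v} e es ¬i = cong length (filter-reject (λ f → em {Incident v f}) {e} {es} ¬i)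

  marks-∷-≤ : ∀ v e es → marks (e ∷ es) v ≤ suc (marks es v)
  marks-∷-≤ v e es with em {Incident v e}
  ... | yes _ = ≤-refl
  ... | no _  = n≤1+n _

  -- Distinct marked edges at `v` have distinct far ends, all of them neighbours listed in `us`;
  -- pigeonhole bounds their number.
  marks<Degree : ∀ {v n es} → Distinct es → Degree< G v n → marks es v < n
  marks<Degree {v} {n} {es} es! (_ , (us , _ , us⇔ , refl) , d<n) = begin-strict
    marks es v                ≡⟨ length-opposites is ⟨
    length (opposites is)     ≤⟨ Unique-⊆⇒length≤ (opposites-Unique is (filter⁺ _ es!))
                                   (λ w∈ → Equivalence.from (us⇔ _) (opposites-adjacent is w∈)) ⟩
    length us                 <⟨ d<n ⟩
    n                         ∎
    where
    open ≤-Reasoning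
    is = all-filter (λ e → em {Incident v e}) es

  vertexScore-unmarked : ∀ p {v} → v List.∉ vertices p → vertexScore p v ≡ marks (edges p) v
  vertexScore-unmarked p {v} v∉ with em {v ∈ vertices p}
  ... | yes v∈ = contradiction v∈ v∉
  ... | no _   = refl

  vertexScore-≤ : ∀ p v {k} → (v List.∉ vertices p → marks (edges p) v ≤ k) → vertexScore p v ≤ k
  vertexScore-≤ p v h with em {v ∈ vertices p}
  ... | yes _ = z≤n
  ... | no v∉ = h v∉

  Score : Position → Pred ℕ ℓ
  Score p j = ∃[ v ] vertexScore p v ≡ j

  -- A round enters `FinalScore≥` only through an exact supremum, so one has to be produced.
  maxScore : ∀ p → ∃[ k ] IsSup (Score p) k
  maxScore p = bounded⇒IsSup em (Score p) (length (edges p)) λ { _ (v , refl) →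
    vertexScore-≤ p v λ _ → length-filter _ (edges p) }

  aliceTurn-just⁻ : ∀ {α p q} → aliceTurn α p ≡ just q →
    ∃[ v ] v List.∉ vertices p × q ≡ position (v ∷ vertices p) (edges p)
  aliceTurn-just⁻ {α} {p} eq with α p
  aliceTurn-just⁻ refl | yes (v , v∉) = v , v∉ , refl

  bobTurn-just⁻ : ∀ {β p q} → bobTurn β p ≡ just q →
    ∃[ e ] ¬ Any (SameEdge e) (edges p) × q ≡ position (vertices p) (e ∷ edges p)
  bobTurn-just⁻ {β} {p} eq with β p
  bobTurn-just⁻ refl | yes (e , e∉) = e , e∉ , refl

  aliceTurn-cong : ∀ {α α′ p} → α p ≡ α′ p → aliceTurn α p ≡ aliceTurn α′ p
  aliceTurn-cong {α} {α′} {p} eq with α p | α′ p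
  aliceTurn-cong refl | yes _ | yes _ = refl
  aliceTurn-cong eq   | no _  | no _  = refl

  bobTurn-cong : ∀ {β β′ p} → β p ≡ β′ p → bobTurn β p ≡ bobTurn β′ p
  bobTurn-cong {β} {β′} {p} eq with β p | β′ p
  bobTurn-cong refl | yes _ | yes _ = refl
  bobTurn-cong eq   | no _  | no _  = refl

  -- Both invariants are indexed by the number of completed rounds: `J r` concerns the middle of
  -- round `suc r`.
  module _ {α : AliceStrategy} {β : BobStrategy} (I J : ℕ → Position → Set b)
    (init  : I 0 start)
    (alice : ∀ {r p q} → I r p → aliceTurn α p ≡ just q → J r q)
    (bob   : ∀ {r p q} → J r p → bobTurn β p ≡ just q → I (suc r) q) where

    afterRound-invariant      : ∀ r {p} → afterRound α β r ≡ just p → I r p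
    afterAlicesTurn-invariant : ∀ r {p} → afterAlicesTurn α β (suc r) ≡ just p → J r p

    afterRound-invariant zero    refl = init
    afterRound-invariant (suc r) eq with >>=-just⁻ (afterAlicesTurn α β (suc r)) eq
    ... | _ , eq₁ , eq₂ = bob (afterAlicesTurn-invariant r eq₁) eq₂

    afterAlicesTurn-invariant r eq with >>=-just⁻ (afterRound α β r) eq
    ... | _ , eq₁ , eq₂ = alice (afterRound-invariant r eq₁) eq₂

  aliceTurn-edges : ∀ {α p q} → aliceTurn α p ≡ just q → edges q ≡ edges p
  aliceTurn-edges {α} eq = cong edges (proj₂ (proj₂ (aliceTurn-just⁻ {α} eq)))

  bobTurn-length : ∀ {β p q} → bobTurn β p ≡ just q → length (edges q) ≡ suc (length (edges p))
  bobTurn-length {β} eq with bobTurn-just⁻ {β} eq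
  ... | _ , _ , refl = refl

  -- Each completed round adds exactly one edge, so a position of a play reveals its round.
  afterAlicesTurn-length : ∀ α β r {p} → afterAlicesTurn α β (suc r) ≡ just p → length (edges p) ≡ r
  afterAlicesTurn-length α β = afterAlicesTurn-invariant {α = α} {β} HasLength HasLength refl
    (λ len eq → trans (cong length (aliceTurn-edges {α} eq)) len)
    (λ len eq → trans (bobTurn-length {β} eq) (cong suc len))
    where
    HasLength : ℕ → Position → Set
    HasLength r p = length (edges p) ≡ r

  -- The first `r` rounds consult Bob only at positions with fewer than `r` marked edges.
  afterRound-cong : ∀ {α β β′} r → (∀ p → length (edges p) < r → β p ≡ β′ p) →
                    afterRound α β r ≡ afterRound α β′ r
  afterRound-cong zero _ = refl
  afterRound-cong {α} {β} {β′} (suc r) agree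
    rewrite sym (afterRound-cong {α} {β} {β′} r (λ p l<r → agree p (<-trans l<r (n<1+n r))))
    with afterAlicesTurn α β (suc r) in eq
  ... | nothing = refl
  ... | just p  = bobTurn-cong {β} {β′} (agree p (s≤s (≤-reflexive (afterAlicesTurn-length α β r eq))))

  -- Realising positions by actual plays.

  record Reachable (α : AliceStrategy) (q : Position) : Set ℓ where
    constructor reached
    field
      strategy : BobStrategy
      round    : ℕ
      isAfter  : afterAlicesTurn α strategy (suc round) ≡ just q

  addEdge : Edge G → Position → Position
  addEdge e p = position (vertices p) (e ∷ edges p)

  reach-start : ∀ {α q} → aliceTurn α start ≡ just q → Reachable α q
  -- Bob has not moved yet, so any strategy will do; `em` supplies one.
  reach-start eq = reached (λ _ → em) 0 eq

  override : BobStrategy → ∀ q → BobMove q → BobStrategy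
  override β q move p with em {p ≡ q}
  ... | yes refl = yes move
  ... | no _     = β p

  override-≡ : ∀ β q move → override β q move q ≡ yes move
  override-≡ β q move with em {q ≡ q}
  ... | yes refl = refl
  ... | no q≢q   = contradiction refl q≢q

  override-≢ : ∀ β q move p → p ≢ q → override β q move p ≡ β p
  override-≢ β q move p p≢q with em {p ≡ q}
  ... | yes p≡q = contradiction p≡q p≢q
  ... | no _    = refl

  -- Redirect Bob's strategy at `q` alone. The positions consulted earlier have fewer edges than
  -- `q`, so the play still arrives at `q`, and there Bob marks `e`.
  reach-step : ∀ {α q q′ e} → Reachable α q → ¬ Any (SameEdge e) (edges q) →
               aliceTurn α (addEdge e q) ≡ just q′ → Reachable α q′
  reach-step {α} {q} {q′} {e} (reached β r eq) e∉ eq′ = reached β′ (suc r) after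
    where
    β′ = override β q (e , e∉)

    agree : ∀ p → length (edges p) < r → β p ≡ β′ p
    agree p l<r = sym (override-≢ β q (e , e∉) p λ p≡q →
      <⇒≢ l<r (trans (cong (length ∘ edges) p≡q) (afterAlicesTurn-length α β r eq)))

    turn : bobTurn β′ q ≡ just (addEdge e q)
    turn rewrite override-≡ β q (e , e∉) = refl

    after : afterAlicesTurn α β′ (suc (suc r)) ≡ just q′
    after rewrite sym (afterRound-cong {α} {β} {β′} r agree) | eq | turn = eq′

  -- Alice's replies in an imagined game.

  respond : AliceStrategy → Position → Position
  -- Without a move for `α` the position is kept: the imagined game may be over while the real one
  -- continues.
  respond α p = fromMaybe p (aliceTurn α p)

  respond-edges : ∀ α p → edges (respond α p) ≡ edges p
  respond-edges α p with α p
  ... | yes _ = refl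
  ... | no _  = refl

  respond-⊇ : ∀ α p → vertices p ⊆ vertices (respond α p)
  respond-⊇ α p with α p
  ... | yes _ = there
  ... | no _  = λ u∈ → u∈

  -- A reply adds at most one mark, so copying it takes at most one real move.
  respond-new-unique : ∀ α p {u w} → u ∈ vertices (respond α p) → w ∈ vertices (respond α p) →
    u List.∉ vertices p → w List.∉ vertices p → u ≡ w
  respond-new-unique α p u∈ w∈ u∉ w∉ with α p
  respond-new-unique α p (here refl) (here refl) u∉ w∉ | yes _ = refl
  respond-new-unique α p (there u∈)  _           u∉ w∉ | yes _ = contradiction u∈ u∉
  respond-new-unique α p (here _)    (there w∈)  u∉ w∉ | yes _ = contradiction w∈ w∉
  respond-new-unique α p u∈ w∈ u∉ w∉ | no _ = contradiction u∈ u∉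

  -- The second alternative covers the positions where α has no answer left.
  Safe : AliceStrategy → Position → Set ℓ
  Safe α q = Reachable α q ⊎ (∀ u → u ∈ vertices q)

  respond-start-Safe : ∀ α → Safe α (respond α start)
  respond-start-Safe α with aliceTurn α start in eq
  ... | just _ = inj₁ (reach-start eq)
  ... | nothing with α start
  -- A strategy may decline only when no vertex is unmarked.
  ...   | no ¬move = inj₂ λ u → decidable-stable em λ u∉ → ¬move (u , u∉)

  -- A fully marked position stays so. A reachable one is extended by `reach-step`, unless `α`
  -- declines, and then everything is marked.
  respond-step-Safe : ∀ α {q e} → Safe α q → ¬ Any (SameEdge e) (edges q) →
                      Safe α (respond α (addEdge e q))
  respond-step-Safe α {q} {e} (inj₂ all∈) e∉ = inj₂ λ u → respond-⊇ α (addEdge e q) (all∈ u)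
  respond-step-Safe α {q} {e} (inj₁ reach) e∉ with aliceTurn α (addEdge e q) in eq
  ... | just _ = inj₁ (reach-step reach e∉ eq)
  ... | nothing with α (addEdge e q)
  ...   | no ¬move = inj₂ λ u → decidable-stable em λ u∉ → ¬move (u , u∉)

  Avoids : ℕ → AliceStrategy → Set ℓ
  Avoids k α = ∀ (β : BobStrategy) r q → afterAlicesTurn α β r ≡ just q →
    ¬ (∃[ v ] v List.∉ vertices q × markedDegree q v ≡ k)

  module _ {m α} (avoids : Avoids m α) where

    -- The counts grow by at most one per round, so they cannot jump over m.
    avoids⇒marks< : ∀ β r {q} → afterAlicesTurn α β (suc r) ≡ just q →
                    ∀ u → u List.∉ vertices q → marks (edges q) u < m
    avoids⇒marks< β r eq u u∉ = ≤∧≢⇒< (bound r eq u u∉) λ ≡m → avoids β (suc r) _ eq (u , u∉ , ≡m)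
      where
      bound : ∀ r {q} → afterAlicesTurn α β (suc r) ≡ just q →
              ∀ u → u List.∉ vertices q → marks (edges q) u ≤ m
      bound r eq u u∉ with >>=-just⁻ (afterRound α β r) eq
      ... | p , eq₁ , eq₂ with aliceTurn-just⁻ {α} eq₂
      bound zero    eq u u∉ | _ , refl , _ | _ , _ , refl = z≤n
      bound (suc r) eq u u∉ | p , eq₁ , _ | _ , _ , refl
        with >>=-just⁻ (afterAlicesTurn α β (suc r)) eq₁
      ... | q , eq₃ , eq₄ with bobTurn-just⁻ {β} eq₄
      -- A vertex unmarked now was unmarked a round ago, and the strict bound from then leaves room
      -- for the one new edge.
      ... | e , _ , refl = ≤-trans (marks-∷-≤ u e (edges q))
                                   (avoids⇒marks< β r eq₃ u (u∉ ∘ there))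

    Safe⇒marks< : ∀ {q} → Safe α q → ∀ u → u List.∉ vertices q → marks (edges q) u < m
    Safe⇒marks< (inj₁ (reached β r eq)) = avoids⇒marks< β r eq
    Safe⇒marks< (inj₂ all∈) u u∉ = contradiction (all∈ u) u∉

-- Transfer between the induced subgraph and the big graph.

module Induced (em : ExcludedMiddle ℓ) (G′ : Graph ℓ) (V : Pred (Vertex G′) ℓ) where
  open Edge

  G : Graph ℓ
  G = induced G′ V

  module Γ  = Game em G
  module Γ′ = Game em G′
  module P  = Plays em G
  module P′ = Plays em G′
  open Γ using (position; vertices; edges)
  open Γ′ using () renaming (position to position′; vertices to vertices′; edges to edges′)

  -- The stored membership proof is irrelevant, but excluded middle makes it recomputable.
  value∈V : (u : Vertex G) → V (value u)
  value∈V (_ , [ v∈V ]) = recompute em v∈V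

  embed : Edge G → Edge G′
  embed (edge a b ab) = edge (value a) (value b) ab

  SameEdge-embed⁺ : ∀ e f → SameEdge e f → SameEdge (embed e) (embed f)
  SameEdge-embed⁺ _ _ (inj₁ (refl , refl)) = inj₁ (refl , refl)
  SameEdge-embed⁺ _ _ (inj₂ (refl , refl)) = inj₂ (refl , refl)

  SameEdge-embed⁻ : ∀ e f → SameEdge (embed e) (embed f) → SameEdge e f
  SameEdge-embed⁻ _ _ (inj₁ (p , q)) = inj₁ (value-injective p , value-injective q)
  SameEdge-embed⁻ _ _ (inj₂ (p , q)) = inj₂ (value-injective p , value-injective q)

  Incident-embed⁺ : ∀ u e → Incident u e → Incident (value u) (embed e)
  Incident-embed⁺ _ _ (inj₁ refl) = inj₁ refl
  Incident-embed⁺ _ _ (inj₂ refl) = inj₂ refl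

  Incident-embed⁻ : ∀ u e → Incident (value u) (embed e) → Incident u e
  Incident-embed⁻ _ _ (inj₁ p) = inj₁ (value-injective p)
  Incident-embed⁻ _ _ (inj₂ p) = inj₂ (value-injective p)

  Any-SameEdge-embed⁻ : ∀ e es → Any (SameEdge (embed e)) (map embed es) → Any (SameEdge e) es
  Any-SameEdge-embed⁻ e (f ∷ _)  (here e~)  = here (SameEdge-embed⁻ e f e~)
  Any-SameEdge-embed⁻ e (_ ∷ es) (there e∈) = there (Any-SameEdge-embed⁻ e es e∈)

  marks-embed : ∀ es u → P′.marks (map embed es) (value u) ≡ P.marks es u
  marks-embed []       u = refl
  marks-embed (e ∷ es) u with em {Incident u e}
  ... | yes i = trans (P′.marks-∷-incident (embed e) (map embed es) (Incident-embed⁺ u e i))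
                      (cong suc (marks-embed es u))
  ... | no ¬i = trans (P′.marks-∷-¬incident (embed e) (map embed es) (¬i ∘ Incident-embed⁻ u e))
                      (marks-embed es u)

  -- Lower bound: Bob copies `β` from an imagined game.

  module Lower (β : Γ.BobStrategy) where

    translate : Vertex G′ → Γ.AliceStrategy
    translate v p with em {Σ[ u ∈ Vertex G ] value u ≡ v × u List.∉ vertices p}
    ... | yes (u , _ , u∉) = yes (u , u∉)
    ... | no _             = em

    translate-marks : ∀ {v p q} → Γ.aliceTurn (translate v) p ≡ just q →
                      ∀ u → value u ≡ v → u ∈ vertices q
    translate-marks {v} {p} eq u u≡v with em {Σ[ u ∈ Vertex G ] value u ≡ v × u List.∉ vertices p}
    translate-marks refl u u≡v | yes (w , w≡v , _) = here (value-injective (trans u≡v (sym w≡v)))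
    translate-marks {v} {p} eq u u≡v | no none with em {Γ.AliceMove p}
    translate-marks refl u u≡v | no none | yes _ =
      -- Here `v` was not copied; if it is a vertex `u` of `G`, the reason is that `u` was already
      -- marked.
      there (decidable-stable em λ u∉ → none (u , u≡v , u∉))

    -- As `β` fixes every reply, Alice's real marks alone determine the imagined game. The value is
    -- `nothing` once that game has ended.
    shadow      : List (Vertex G′) → Maybe Γ.Position
    shadowAlice : List (Vertex G′) → Maybe Γ.Position

    shadow []       = just Γ.start
    shadow (v ∷ vs) = shadowAlice (v ∷ vs) >>= Γ.bobTurn β

    shadowAlice []       = nothing
    shadowAlice (v ∷ vs) = shadow vs >>= Γ.aliceTurn (translate v)

    Proposed : List (Vertex G′) → Edge G → Set ℓ
    Proposed vs f = ∃[ q ] shadowAlice vs ≡ just q × Γ.bobTurn β q ≡ just (P.addEdge f q)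

    -- `β′` obtains its edge from `em` as an unspecified witness; uniqueness shows that it is the
    -- reply of `β`.
    Proposed-unique : ∀ {vs f g} → Proposed vs f → Proposed vs g → f ≡ g
    Proposed-unique (q , eq₁ , eq₂) (_ , eq₁′ , eq₂′)
      with refl ← just-injective (trans (sym eq₁) eq₁′) =
      ∷-injectiveˡ (cong edges (just-injective (trans (sym eq₂) eq₂′)))

    BobCopies : Γ′.Position → Set ℓ
    BobCopies p = Σ[ f ∈ Edge G ] Proposed (vertices′ p) f × ¬ Any (SameEdge (embed f)) (edges′ p)

    β′ : Γ′.BobStrategy
    β′ p with em {BobCopies p}
    ... | yes (f , _ , f∉) = yes (embed f , f∉)
    -- Nothing to copy: no edge is proposed, or the proposed one is already marked.
    ... | no _             = em

    bobTurn-β′ : ∀ p {f} → Proposed (vertices′ p) f → ¬ Any (SameEdge (embed f)) (edges′ p) →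
                 Γ′.bobTurn β′ p ≡ just (P′.addEdge (embed f) p)
    bobTurn-β′ p {f} prop f∉ with em {BobCopies p}
    ... | yes (g , prop′ , _) = cong (λ h → just (P′.addEdge (embed h) p)) (Proposed-unique {vertices′ p} prop′ prop)
    ... | no none             = contradiction (f , prop , f∉) none

    module _ (α′ : Γ′.AliceStrategy) where

      -- The round is read off the number of marked edges; the real game
      -- up to that round is determined by α′ and β′.
      α : Γ.AliceStrategy
      α p with Γ′.afterRound α′ β′ (length (edges p))
      ... | nothing = em
      ... | just p′ with α′ p′
      ...   | yes (v , _) = translate v p
      ...   | no _        = em

      α-translates : ∀ {p p′ v v∉} → Γ′.afterRound α′ β′ (length (edges p)) ≡ just p′ →
                     α′ p′ ≡ yes (v , v∉) → α p ≡ translate v p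
      α-translates after eq rewrite after | eq = refl

      -- `covers` goes one way only, since substitute moves may mark vertices in the imagined game
      -- that are unmarked in the real one.
      record Shadows (p : Γ.Position) (p′ : Γ′.Position) : Set ℓ where
        field
          sameEdges : edges′ p′ ≡ map embed (edges p)
          covers    : ∀ u → value u ∈ vertices′ p′ → u ∈ vertices p

      open Shadows

      -- Keeps in step the play of `α` against `β`, that of `α′` against `β′`, and `shadow`. The
      -- edge count is there because `α` reads the round off it.
      RoundInv AliceInv : ℕ → Γ.Position → Set ℓ
      RoundInv r p = length (edges p) ≡ r × ∃[ p′ ] Γ′.afterRound α′ β′ r ≡ just p′ ×
        shadow (vertices′ p′) ≡ just p × Shadows p p′
      AliceInv r p = length (edges p) ≡ r × ∃[ p′ ] Γ′.afterAlicesTurn α′ β′ (suc r) ≡ just p′ ×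
        shadowAlice (vertices′ p′) ≡ just p × Shadows p p′

      init-inv : RoundInv 0 Γ.start
      init-inv = refl , Γ′.start , refl , refl , record { sameEdges = refl ; covers = λ _ () }

      alice-inv : ∀ {r p q} → RoundInv r p → Γ.aliceTurn α p ≡ just q → AliceInv r q
      alice-inv {p = p} (refl , p′ , after , sh , s) turn
        with P.aliceTurn-just⁻ {α} turn | α′ p′ in eq
      -- The real game cannot stop first: `w` is unmarked in the imagined game, hence by `covers`
      -- also in the real one.
      ... | w , w∉ , refl | no ¬move = contradiction (value w , w∉ ∘ covers s w) ¬move
      ... | w , w∉ , refl | yes (v , v∉) =
        refl , _ , after′ , shadowed , record { sameEdges = sameEdges s ; covers = covers′ }
        where
        after′ : Γ′.afterAlicesTurn α′ β′ (suc (length (edges p))) ≡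
                 just (position′ (v ∷ vertices′ p′) (edges′ p′))
        after′ rewrite after | eq = refl

        turn′ : Γ.aliceTurn (translate v) p ≡ just (position (w ∷ vertices p) (edges p))
        turn′ = trans (sym (P.aliceTurn-cong {α} {translate v} (α-translates after eq))) turn

        shadowed : shadowAlice (v ∷ vertices′ p′) ≡ just (position (w ∷ vertices p) (edges p))
        shadowed rewrite sh = turn′

        covers′ : ∀ u → value u ∈ v ∷ vertices′ p′ → u ∈ w ∷ vertices p
        covers′ u (here u≡v) = translate-marks turn′ u u≡v
        covers′ u (there u∈) = there (covers s u u∈)

      bob-inv : ∀ {r p q} → AliceInv r p → Γ.bobTurn β p ≡ just q → RoundInv (suc r) q
      bob-inv {r} {p} (refl , p′ , after , sh , s) turn with P.bobTurn-just⁻ {β} turn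
      ... | f , f∉ , refl = refl , P′.addEdge (embed f) p′ , after′ , shadowed (vertices′ p′) sh ,
        record { sameEdges = cong (embed f ∷_) (sameEdges s) ; covers = covers s }
        where
        f∉′ : ¬ Any (SameEdge (embed f)) (edges′ p′)
        f∉′ = f∉ ∘ Any-SameEdge-embed⁻ f (edges p) ∘ subst (Any (SameEdge (embed f))) (sameEdges s)

        after′ : Γ′.afterRound α′ β′ (suc r) ≡ just (P′.addEdge (embed f) p′)
        after′ rewrite after = bobTurn-β′ p′ (p , sh , turn) f∉′

        -- Matching on the list lets `shadow` unfold; on the empty list `shadowAlice` is `nothing`.
        shadowed : ∀ vs → shadowAlice vs ≡ just p → shadow vs ≡ just (P.addEdge f p)
        shadowed (v ∷ vs) sh rewrite sh = turn

      score-≤ : ∀ {p p′} → Shadows p p′ → ∀ u → Γ.vertexScore p u ≤ Γ′.vertexScore p′ (value u)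
      score-≤ {p} {p′} s u = P.vertexScore-≤ p u λ u∉ → ≤-reflexive (begin
        P.marks (edges p) u                         ≡⟨ marks-embed (edges p) u ⟨
        P′.marks (map embed (edges p)) (value u)    ≡⟨ cong (λ es → P′.marks es (value u)) (sameEdges s) ⟨
        P′.marks (edges′ p′) (value u)              ≡⟨ P′.vertexScore-unmarked p′ (u∉ ∘ covers s u) ⟨
        Γ′.vertexScore p′ (value u)                 ∎)
        where open ≡-Reasoning

      finalScore : ∀ {s} → Γ.FinalScore≥ α β s → Γ′.FinalScore≥ α′ β′ s
      -- An upper bound `b` of the real round scores also bounds the imagined ones, comparing the
      -- same round `r` in both games.
      finalScore final b bounds = final b λ { k (r , 1≤r , p , after , _ , k≤sup) →
        let _ , p′ , after′ , _ , s = P.afterRound-invariant {α = α} {β} RoundInv AliceInv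
                                        init-inv alice-inv bob-inv r after
            k′ , sup′ = P′.maxScore p′
        in k≤sup b λ { _ (u , refl) → begin
          Γ.vertexScore p u            ≤⟨ score-≤ s u ⟩
          Γ′.vertexScore p′ (value u)  ≤⟨ proj₁ sup′ _ (value u , refl) ⟩
          k′                           ≤⟨ bounds k′ (r , 1≤r , p′ , after′ , sup′) ⟩
          b                            ∎ } }
        where open ≤-Reasoning

  BobWins-induced : ∀ {s} → Γ.BobWins s → Γ′.BobWins s
  BobWins-induced (β , wins) = β′ , λ α′ → finalScore α′ (wins (α α′))
    where open Lower β

  -- Upper bound: Alice replays `α` and answers the edges leaving `V`.

  Inside : Edge G′ → Set ℓ
  Inside e = V (end₁ e) × V (end₂ e)

  restrict : ∀ e → Inside e → Edge G
  restrict (edge a b ab) (a∈V , b∈V) = edge (a , [ a∈V ]) (b , [ b∈V ]) ab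

  -- If `u` and `w` sat at opposite ends of `e`, both ends would be in `V`. So such an edge demands
  -- at most one mark from Alice.
  ¬Inside⇒unique : ∀ e {u w} → ¬ Inside e → Incident (value u) e → Incident (value w) e → u ≡ w
  ¬Inside⇒unique _ ¬in (inj₁ p) (inj₁ q) = value-injective (trans p (sym q))
  ¬Inside⇒unique _ ¬in (inj₂ p) (inj₂ q) = value-injective (trans p (sym q))
  ¬Inside⇒unique _ {u} {w} ¬in (inj₁ p) (inj₂ q) =
    contradiction (subst V p (value∈V u) , subst V q (value∈V w)) ¬in
  ¬Inside⇒unique _ {u} {w} ¬in (inj₂ p) (inj₁ q) =
    contradiction (subst V q (value∈V w) , subst V p (value∈V u)) ¬in

  module Upper (α : Γ.AliceStrategy) where

    -- As `α` fixes every reply, Bob's edges alone determine the imagined game. Values are taken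
    -- after Alice's reply, the base case being her opening move.
    replay : List (Edge G′) → Γ.Position
    replay [] = P.respond α Γ.start
    replay (e ∷ es) with em {Inside e}
    ... | yes i = P.respond α (P.addEdge (restrict e i) (replay es))
    ... | no _  = replay es

    -- Transfers legality: an edge inside `V` that is new in the real game is also new in the
    -- replay.
    replay-edges : ∀ f es → Any (SameEdge f) (edges (replay es)) → Any (SameEdge (embed f)) es
    replay-edges f [] f∈ rewrite P.respond-edges α Γ.start with () ← f∈
    replay-edges f (e ∷ es) f∈ with em {Inside e}
    ... | no _ = there (replay-edges f es f∈)
    ... | yes i rewrite P.respond-edges α (P.addEdge (restrict e i) (replay es)) with f∈
    ...   | here f~   = here (SameEdge-embed⁺ f (restrict e i) f~)
    ...   | there f∈′ = there (replay-edges f es f∈′)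

    replay-Safe : ∀ {es} → P′.Distinct es → P.Safe α (replay es)
    replay-Safe [] = P.respond-start-Safe α
    replay-Safe {e ∷ es} (e≁ ∷ es!) with em {Inside e}
    ... | no _  = replay-Safe es!
    ... | yes i = P.respond-step-Safe α (replay-Safe es!)
      (All¬⇒¬Any e≁ ∘ replay-edges (restrict e i) es)

    Crossing : Vertex G → Edge G′ → Set ℓ
    Crossing u e = ¬ Inside e × Incident (value u) e

    -- The vertices Alice wants marked once Bob has marked es.
    Demanded : List (Edge G′) → Vertex G → Set ℓ
    Demanded es u = u ∈ vertices (replay es) ⊎ Any (Crossing u) es

    -- An edge inside `V` adds only the single reply of `α`; any other edge leaves the replay
    -- unchanged and has at most one end in `V`.
    Demanded-new-unique : ∀ e es {u w} → Demanded (e ∷ es) u → Demanded (e ∷ es) w →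
      ¬ Demanded es u → ¬ Demanded es w → u ≡ w
    Demanded-new-unique e es du dw ¬u ¬w with em {Inside e}
    Demanded-new-unique e es (inj₁ u∈) (inj₁ w∈) ¬u ¬w | yes i =
      P.respond-new-unique α (P.addEdge (restrict e i) (replay es)) u∈ w∈ (¬u ∘ inj₁) (¬w ∘ inj₁)
    Demanded-new-unique e es (inj₂ (here (o , _))) _ ¬u ¬w | yes i = contradiction i o
    Demanded-new-unique e es _ (inj₂ (here (o , _))) ¬u ¬w | yes i = contradiction i o
    Demanded-new-unique e es (inj₁ u∈) _ ¬u ¬w | no _ = contradiction (inj₁ u∈) ¬u
    Demanded-new-unique e es _ (inj₁ w∈) ¬u ¬w | no _ = contradiction (inj₁ w∈) ¬w
    Demanded-new-unique e es (inj₂ (here (_ , p))) (inj₂ (here (_ , q))) ¬u ¬w | no o =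
      ¬Inside⇒unique e o p q
    Demanded-new-unique e es (inj₂ (there u∈)) _ ¬u ¬w | _ = contradiction (inj₂ u∈) ¬u
    Demanded-new-unique e es _ (inj₂ (there w∈)) ¬u ¬w | _ = contradiction (inj₂ w∈) ¬w

    -- Without crossing edges at `u`, every marked edge there is inside `V` and therefore occurs in
    -- the replay.
    marks-replay : ∀ es {u} → ¬ Any (Crossing u) es →
                   P′.marks es (value u) ≤ P.marks (edges (replay es)) u
    marks-replay [] _ = z≤n
    marks-replay (e ∷ es) {u} ¬cross with em {Inside e}
    ... | no o = ≤-trans
      (≤-reflexive (P′.marks-∷-¬incident e es λ i → ¬cross (here (o , i))))
      (marks-replay es (¬cross ∘ there))
    ... | yes i rewrite P.respond-edges α (P.addEdge (restrict e i) (replay es))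
        with em {Incident u (restrict e i)}
    ...   | yes inc = ≤-trans (P′.marks-∷-≤ (value u) e es) (s≤s (marks-replay es (¬cross ∘ there)))
    ...   | no ¬inc = ≤-trans
      (≤-reflexive (P′.marks-∷-¬incident e es (¬inc ∘ Incident-embed⁻ u (restrict e i))))
      (marks-replay es (¬cross ∘ there))

    Owed : Γ′.Position → Set ℓ
    Owed p = Σ[ u ∈ Vertex G ] Demanded (edges′ p) u × value u List.∉ vertices′ p

    α′ : Γ′.AliceStrategy
    α′ p with em {Owed p}
    ... | yes (u , _ , u∉) = yes (value u , u∉)
    ... | no _             = em

    module _ (β′ : Γ′.BobStrategy) {m : ℕ} (avoids : P.Avoids m α)
      (outer : ∀ v → v ∉ V → Degree< G′ v (suc m)) where

      -- Bob's turn creates at most one debt and Alice's next turn settles it, so nothing is owed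
      -- after her turns.
      record AliceInv (p : Γ′.Position) : Set ℓ where
        field
          distinct : P′.Distinct (edges′ p)
          paid     : ∀ u → Demanded (edges′ p) u → value u ∈ vertices′ p

      record RoundInv (p : Γ′.Position) : Set ℓ where
        field
          distinct : P′.Distinct (edges′ p)
          oneOwed  : (o o′ : Owed p) → proj₁ o ≡ proj₁ o′
          low      : ∀ v → Γ′.vertexScore p v ≤ m

      init-inv : RoundInv Γ′.start
      init-inv = record
        { distinct = []
        -- Before any move, the only possible debt is the opening mark of `α`.
        ; oneOwed  = λ { (_ , inj₁ u∈ , _) (_ , inj₁ w∈ , _) →
            P.respond-new-unique α Γ.start u∈ w∈ (λ ()) (λ ()) }
        ; low      = λ v → P′.vertexScore-≤ Γ′.start v λ _ → z≤n
        }

      alice-inv : ∀ {p q} → RoundInv p → Γ′.aliceTurn α′ p ≡ just q → AliceInv q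
      alice-inv {p} inv turn with em {Owed p}
      alice-inv {p} inv refl | yes o@(u , _ , _) = record
        { distinct = RoundInv.distinct inv
        -- A demanded `w` that is still unmarked was owed before this turn, so it equals the vertex
        -- just marked.
        ; paid = λ w dem → decidable-stable em λ w∉ →
            w∉ (here (cong value (RoundInv.oneOwed inv (w , dem , w∉ ∘ there) o)))
        }
      alice-inv {p} inv turn | no none with em {Γ′.AliceMove p}
      alice-inv {p} inv refl | no none | yes _ = record
        { distinct = RoundInv.distinct inv
        ; paid = λ w dem → there (decidable-stable em λ w∉ → none (w , dem , w∉))
        }

      bob-inv : ∀ {p q} → AliceInv p → Γ′.bobTurn β′ p ≡ just q → RoundInv q
      bob-inv {p} inv turn with P′.bobTurn-just⁻ {β′} turn
      ... | e , e∉ , refl = record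
        { distinct = distinct′
        ; oneOwed  = λ { (u , du , u∉) (w , dw , w∉) →
            Demanded-new-unique e (edges′ p) du dw (u∉ ∘ paid u) (w∉ ∘ paid w) }
        ; low      = λ v → P′.vertexScore-≤ (P′.addEdge e p) v (low v)
        }
        where
        open AliceInv inv
        open ≤-Reasoning

        distinct′ : P′.Distinct (e ∷ edges′ p)
        distinct′ = ¬Any⇒All¬ _ e∉ ∷ distinct

        low : ∀ v → v List.∉ vertices′ p → P′.marks (e ∷ edges′ p) v ≤ m
        low v v∉ with em {V v}
        ... | no v∉V  = s≤s⁻¹ (P′.marks<Degree distinct′ (outer v v∉V))
        ... | yes v∈V = begin
          P′.marks (e ∷ edges′ p) v                    ≤⟨ P′.marks-∷-≤ v e (edges′ p) ⟩
          suc (P′.marks (edges′ p) v)                  ≤⟨ s≤s (marks-replay (edges′ p) (v∉ ∘ paid u ∘ inj₂)) ⟩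
          -- The strict bound left by `α` absorbs the one edge that Bob has just marked.
          suc (P.marks (edges (replay (edges′ p))) u)  ≤⟨ P.Safe⇒marks< avoids (replay-Safe distinct) u (v∉ ∘ paid u ∘ inj₁) ⟩
          m                                            ∎
          where
          u : Vertex G
          u = v , [ v∈V ]

      finalScore-≤ : ∀ {s} → Γ′.FinalScore≥ α′ β′ s → s ≤ m
      finalScore-≤ final = final m λ { k (r , _ , p , after , _ , k≤sup) →
        k≤sup m λ { _ (v , refl) → RoundInv.low
          (P′.afterRound-invariant {α = α′} {β′} (λ _ → RoundInv) (λ _ → AliceInv)
            init-inv alice-inv bob-inv r after) v } }

  BobWins-≤ : ∀ {m s} → Γ.AliceCanAvoid m → (∀ v → v ∉ V → Degree< G′ v (suc m)) →
              Γ′.BobWins s → s ≤ m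
  BobWins-≤ (α , avoids) outer (β′ , wins) = finalScore-≤ β′ avoids outer (wins α′)
    where open Upper α

theorem4p3 : ∀ {ℓ} (em : ExcludedMiddle ℓ) (G′ : Graph ℓ) (V : Pred (Vertex G′) ℓ) (n : ℕ) →
    (∀ v → v ∉ V → Degree< G′ v n) →
    ColVe em (induced G′ V) n →
    AliceCanAvoid em (induced G′ V) (n ∸ 1) →
    ColVe em G′ n
theorem4p3 em G′ V _ outer (m , (_ , m≤sup) , refl) avoid =
  -- As `n` is `suc m`, `n ∸ 1` reduces to `m`: the avoided count of `α` is exactly the score to be
  -- bounded.
  m , ((λ _ wins → BobWins-≤ avoid outer wins) , λ b bounds → m≤sup b λ k wins → bounds k (BobWins-induced wins)) , refl
  where open Induced em G′ V
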